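{- For every $k\in\mathbb{N}$ and every $n\in\mathbb{N}$ there are vectors $x_1,\dots,x_n\in c_{00}$ such that, with $x=\sum_{i=1}^n x_i$: (1) $\|x_i\|_k=\tfrac12$ for $i=1,\dots,n$; (2) $\|x\|_k\le 1$; (3) $\|x\|_{k+1}\ge \tfrac n4$.
   Context: $c_{00}$ denotes the vector space of finitely supported real sequences, with canonical basis $(t_n)_{n\ge 1}$. For finite nonempty $E,F\subset\mathbb{N}$ write $E<F$ if $\max E<\min F$, and $k\le E$ if $k\le\min E$; for $x=\sum_n a_nt_n$ put $Ex=\sum_{n\in E}a_nt_n$. The iterates of the Tsirelson (Figiel–Johnson) norm are defined by $\|x\|_0=\max_n|a_n|$ and, for $m\ge 0$, \[ \|x\|_{m+1}=\max\Big\{\|x\|_m,\ \max\Big\{\tfrac12\sum_{i=1}^{k}\|E_ix\|_m : k\in\mathbb{N},\ k\le E_1<E_2<\dots<E_k\Big\}\Big\}. \] $\|\cdot\|_m$ is called the $m$-th iterate in the construction of the Tsirelson norm. -}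

module Defs where

open import Data.Nat as ℕ using (ℕ; zero; suc)
open import Data.Integer using (+_)
open import Data.Rational using (ℚ; 0ℚ; ½; _+_; _*_; _⊔_; ∣_∣; _/_)
open import Data.Bool using (Bool; true; false; if_then_else_)
open import Data.List using (List; []; _∷_; map; concatMap; foldr; length; filter)
open import Data.List.Membership.DecPropositional (ℕ._≟_) using (_∈?_)
open import Relation.Nullary.Decidable using (does)
open import Data.Fin using (Fin)

-- An element of c₀₀ (with rational coefficients): the list a₁ ∷ a₂ ∷ … ∷ a_L
-- represents x = Σ_{n=1}^{L} a_n t_n (index n is 1-based).
C00 : Set
C00 = List ℚ

_⊕_ : C00 → C00 → C00
[] ⊕ ys = ys
(x ∷ xs) ⊕ [] = x ∷ xs
(x ∷ xs) ⊕ (y ∷ ys) = (x + y) ∷ (xs ⊕ ys)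

sumC00 : {n : ℕ} → (Fin n → C00) → C00
sumC00 {zero} f = []
sumC00 {suc n} f = f Fin.zero ⊕ sumC00 {n} (λ i → f (Fin.suc i))

restrictFrom : ℕ → List ℕ → C00 → C00
restrictFrom p E [] = []
restrictFrom p E (a ∷ xs) =
  (if does (p ∈? E) then a else 0ℚ) ∷ restrictFrom (suc p) E xs

restrict : List ℕ → C00 → C00
restrict = restrictFrom 1

supNorm : C00 → ℚ
supNorm = foldr (λ a r → ∣ a ∣ ⊔ r) 0ℚ

-- All families E₁ < E₂ < … < E_k (k ≥ 0) of nonempty subsets of
-- {p, p+1, …, p+c-1}, each E_i given as a strictly increasing list.
-- Element p is either unused, forms a new first block {p}, or is
-- added to the first block of a family of subsets of {p+1, …}.
families : ℕ → ℕ → List (List (List ℕ))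
families p zero = [] ∷ []
families p (suc c) = concatMap step (families (suc p) c)
  where
  step : List (List ℕ) → List (List (List ℕ))
  step [] = [] ∷ ((p ∷ []) ∷ []) ∷ []
  step (E ∷ F) = (E ∷ F) ∷ ((p ∷ []) ∷ E ∷ F) ∷ ((p ∷ E) ∷ F) ∷ []

-- admissibility: k ≤ E₁ (i.e. k ≤ min E₁), where k = number of sets
admissible : List (List ℕ) → Bool
admissible [] = true
admissible ((e ∷ E) ∷ F) = does (suc (length F) ℕ.≤? e)
admissible ([] ∷ F) = false

-- Admissible families of subsets of {1, …, L}, L = length of x.
-- (Sets E_i, or parts of them, outside the support of x contribute
-- nothing, so the maximum in the definition is attained on these.)
admissibleFamilies : C00 → List (List (List ℕ))
admissibleFamilies x = filter (λ F → Relation.Nullary.Decidable.Core.T? (admissible F)) (families 1 (length x))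
  where import Relation.Nullary.Decidable.Core

tsNorm : ℕ → C00 → ℚ
tsNorm zero x = supNorm x
tsNorm (suc m) x =
  tsNorm m x ⊔
  foldr _⊔_ 0ℚ
    (map (λ F → ½ * foldr (λ E r → tsNorm m (restrict E x) + r) 0ℚ F)
         (admissibleFamilies x))

{-# OPTIONS --safe #-}
-- Induct on k, producing arbitrarily far out successive blocks x₁ < … < xₙ with
-- ‖xᵢ‖ₖ = ½ and ‖Σ xᵢ‖ₖ ≤ 1. Once n ≤ supp x₁, the supports of the blocks form
-- an admissible family, whence ‖Σ xᵢ‖ₖ₊₁ ≥ ½ Σ ‖xᵢ‖ₖ = n/4. Thus z = Σ xᵢ,
-- rescaled to ‖z‖ₖ₊₁ = ½, has ‖z‖ₖ ≤ 2/n. Choosing each block of the next level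
-- in this way, with ‖·‖ₖ tiny compared to 1/N for N the end of the previous
-- block, keeps the sum bounded in ‖·‖ₖ₊₁: an admissible family starting inside
-- xᵢ has at most N = max supp xᵢ members, so it collects at most ‖xᵢ‖ₖ₊₁ = ½
-- from xᵢ and at most ½ from all later blocks together.

module Submission where

open import Defs
open import Data.Nat using (ℕ; suc)
open import Data.Integer using (+_)
open import Data.Rational using (ℚ; ½; 1ℚ; _≤_; _/_)
open import Data.Fin using (Fin)
open import Data.Product using (Σ; _×_)
open import Relation.Binary.PropositionalEquality using (_≡_)

open import Data.Bool using (Bool; true; false; if_then_else_; _∨_; T)
open import Data.Bool.Properties using (T?)
open import Data.Empty using (⊥-elim)
import Data.Fin as Fin
open import Data.Integer.Solver using (module +-*-Solver)
open import Data.List using (List; []; _∷_; map; foldr; length)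
open import Data.List.Membership.DecPropositional Data.Nat._≟_ using (_∈?_)
open import Data.List.Membership.Propositional using (_∈_; find; lose)
open import Data.List.Membership.Propositional.Properties
  using (∈-concatMap⁻; ∈-concatMap⁺; ∈-filter⁺; ∈-filter⁻)
open import Data.List.Properties using (length-map)
open import Data.List.Relation.Unary.All as All using (All; []; _∷_)
open import Data.List.Relation.Unary.Any using (here; there)
import Data.Nat as ℕ
import Data.Nat.Properties as ℕ
open import Data.Product using (∃; _,_; proj₁; proj₂)
open import Data.Rational
  using (0ℚ; _+_; _*_; _⊔_; ∣_∣; 1/_; NonNegative; NonZero; Positive; nonNegative; positive; toℚᵘ)
open import Data.Rational.Properties
open import Data.Rational.Solver renaming (module +-*-Solver to ℚ-Solver)
open import Data.Rational.Unnormalised as ℚᵘ using (mkℚᵘ; *≡*)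
import Data.Rational.Unnormalised.Properties as ℚᵘ
import Data.Vec.Functional as Vector
open import Function using (_∘_)
open import Relation.Nullary using (yes; no; does)
open import Relation.Nullary.Decidable using (dec-true; dec-false)
open import Relation.Binary.PropositionalEquality
  using (refl; sym; trans; cong; cong₂; subst)

private variable
  c k n p q N : ℕ
  E E′ : List ℕ
  F F′ : List (List ℕ)

-- Coordinates; the list position j carries the coefficient of t_{j+1}.
infixl 9 _!_
_!_ : C00 → ℕ → ℚ
[]      ! _       = 0ℚ
(a ∷ x) ! ℕ.zero  = a
(a ∷ x) ! (suc j) = x ! j

!-beyond : ∀ x {j} → length x ℕ.≤ j → x ! j ≡ 0ℚ
!-beyond []      _            = refl
!-beyond (a ∷ x) (ℕ.s≤s l≤j) = !-beyond x l≤j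

⊕-! : ∀ x y j → (x ⊕ y) ! j ≡ x ! j + y ! j
⊕-! []      y       j        = sym (+-identityˡ (y ! j))
⊕-! (a ∷ x) []      j        = sym (+-identityʳ ((a ∷ x) ! j))
⊕-! (a ∷ x) (b ∷ y) ℕ.zero   = refl
⊕-! (a ∷ x) (b ∷ y) (suc j) = ⊕-! x y j

⊕-!ˡ : ∀ x y {j} → y ! j ≡ 0ℚ → (x ⊕ y) ! j ≡ x ! j
⊕-!ˡ x y {j} y≡0 = trans (⊕-! x y j) (trans (cong (λ a → x ! j + a) y≡0) (+-identityʳ _))

⊕-!ʳ : ∀ x y {j} → x ! j ≡ 0ℚ → (x ⊕ y) ! j ≡ y ! j
⊕-!ʳ x y {j} x≡0 = trans (⊕-! x y j) (trans (cong (λ a → a + y ! j) x≡0) (+-identityˡ _))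

restrictFrom-! : ∀ p E x j →
  restrictFrom p E x ! j ≡ (if does (p ℕ.+ j ∈? E) then x ! j else 0ℚ)
restrictFrom-! p E [] j with does (p ℕ.+ j ∈? E)
... | true  = refl
... | false = refl
restrictFrom-! p E (a ∷ x) ℕ.zero rewrite ℕ.+-identityʳ p = refl
restrictFrom-! p E (a ∷ x) (suc j) rewrite ℕ.+-suc p j = restrictFrom-! (suc p) E x j

restrict-!-∈ : ∀ E x {j} → suc j ∈ E → restrict E x ! j ≡ x ! j
restrict-!-∈ E x {j} j∈E =
  trans (restrictFrom-! 1 E x j)
        (cong (if_then x ! j else 0ℚ) (dec-true (suc j ∈? E) j∈E))

if-0 : ∀ (b : Bool) {a} → a ≡ 0ℚ → (if b then a else 0ℚ) ≡ 0ℚ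
if-0 true  a≡0 = a≡0
if-0 false _   = refl

restrict-!-0 : ∀ E x {j} → x ! j ≡ 0ℚ → restrict E x ! j ≡ 0ℚ
restrict-!-0 E x {j} x≡0 = trans (restrictFrom-! 1 E x j) (if-0 (does (suc j ∈? E)) x≡0)

restrictFrom-⊕ : ∀ p E x y → restrictFrom p E (x ⊕ y) ≡ restrictFrom p E x ⊕ restrictFrom p E y
restrictFrom-⊕ p E []      y       = refl
restrictFrom-⊕ p E (a ∷ x) []      = refl
restrictFrom-⊕ p E (a ∷ x) (b ∷ y) = cong₂ _∷_ (if-+ (does (p ∈? E))) (restrictFrom-⊕ (suc p) E x y)
  where
  if-+ : ∀ t → (if t then a + b else 0ℚ) ≡ (if t then a else 0ℚ) + (if t then b else 0ℚ)
  if-+ true  = refl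
  if-+ false = refl

scale : ℚ → C00 → C00
scale r = map (r *_)

scale-! : ∀ r x j → scale r x ! j ≡ r * x ! j
scale-! r []      j       = sym (*-zeroʳ r)
scale-! r (a ∷ x) ℕ.zero  = refl
scale-! r (a ∷ x) (suc j) = scale-! r x j

restrictFrom-scale : ∀ r p E x → restrictFrom p E (scale r x) ≡ scale r (restrictFrom p E x)
restrictFrom-scale r p E []      = refl
restrictFrom-scale r p E (a ∷ x) = cong₂ _∷_ (if-* (does (p ∈? E))) (restrictFrom-scale r (suc p) E x)
  where
  if-* : ∀ t → (if t then r * a else 0ℚ) ≡ r * (if t then a else 0ℚ)
  if-* true  = refl
  if-* false = sym (*-zeroʳ r)

restrictFrom-cong : ∀ p x → (∀ j → j ℕ.< p ℕ.+ length x → does (j ∈? E) ≡ does (j ∈? E′)) →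
  restrictFrom p E x ≡ restrictFrom p E′ x
restrictFrom-cong p []      eq = refl
restrictFrom-cong p (a ∷ x) eq = cong₂ _∷_
  (cong (if_then a else 0ℚ) (eq p (ℕ.m<m+n p ℕ.z<s)))
  (restrictFrom-cong (suc p) x λ j j< → eq j (subst (j ℕ.<_) (sym (ℕ.+-suc p _)) j<))

-- Families of successive sets

-- Inductive counterpart of membership in `families p c`, so that families can be built and analysed
-- by pattern matching instead of through `concatMap`.
data Family (p : ℕ) : ℕ → List (List ℕ) → Set where
  empty : Family p 0 []
  skip  : Family (suc p) c F       → Family p (suc c) F
  start : Family (suc p) c F       → Family p (suc c) ((p ∷ []) ∷ F)
  grow  : Family (suc p) c (E ∷ F) → Family p (suc c) ((p ∷ E) ∷ F)

∈-families⁻ : ∀ p c → F ∈ families p c → Family p c F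
∈-families⁻ p ℕ.zero  (here refl) = empty
∈-families⁻ p (suc c) F∈ with find (∈-concatMap⁻ _ {xs = families (suc p) c} F∈)
... | []    , G∈ , here refl                 = skip (∈-families⁻ (suc p) c G∈)
... | []    , G∈ , there (here refl)         = start (∈-families⁻ (suc p) c G∈)
... | _ ∷ _ , G∈ , here refl                 = skip (∈-families⁻ (suc p) c G∈)
... | _ ∷ _ , G∈ , there (here refl)         = start (∈-families⁻ (suc p) c G∈)
... | _ ∷ _ , G∈ , there (there (here refl)) = grow (∈-families⁻ (suc p) c G∈)

∈-families⁺ : Family p c F → F ∈ families p c
∈-families⁺ empty = here refl
∈-families⁺ {p} {suc c} (skip {F = []} f) =
  ∈-concatMap⁺ _ (lose (∈-families⁺ f) (here refl))
∈-families⁺ {p} {suc c} (skip {F = _ ∷ _} f) =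
  ∈-concatMap⁺ _ (lose (∈-families⁺ f) (here refl))
∈-families⁺ {p} {suc c} (start {F = []} f) =
  ∈-concatMap⁺ _ (lose (∈-families⁺ f) (there (here refl)))
∈-families⁺ {p} {suc c} (start {F = _ ∷ _} f) =
  ∈-concatMap⁺ _ (lose (∈-families⁺ f) (there (here refl)))
∈-families⁺ {p} {suc c} (grow f) =
  ∈-concatMap⁺ _ (lose (∈-families⁺ f) (there (there (here refl))))

AllAbove : ℕ → List (List ℕ) → Set
AllAbove q = All (All (q ℕ.≤_))

AllAbove-≤ : p ℕ.≤ q → AllAbove q F → AllAbove p F
AllAbove-≤ p≤q = All.map (All.map (ℕ.≤-trans p≤q))

family-above : Family p c F → AllAbove p F
family-above empty     = []
family-above (skip f)  = AllAbove-≤ (ℕ.n≤1+n _) (family-above f)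
family-above (start f) = (ℕ.≤-refl ∷ []) ∷ AllAbove-≤ (ℕ.n≤1+n _) (family-above f)
family-above (grow f) with AllAbove-≤ (ℕ.n≤1+n _) (family-above f)
... | e ∷ fs = (ℕ.≤-refl ∷ e) ∷ fs

family-nonempty : Family p c ([] ∷ F) → ∀ {A : Set} → A
family-nonempty (skip f) = family-nonempty f

-- Once the leading `skip`s are stripped, the first index used is `e` itself, and `family-above`
-- applies there.
family-above-min : ∀ {e} → Family p c ((e ∷ E) ∷ F) → AllAbove e ((e ∷ E) ∷ F)
family-above-min (skip f)    = family-above-min f
family-above-min f@(start _) = family-above f
family-above-min f@(grow _)  = family-above f

no-blocks : ∀ p c → Family p c []
no-blocks p ℕ.zero  = empty
no-blocks p (suc c) = skip (no-blocks (suc p) c)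

family-from-1 : ∀ N → Family (suc N) c F → ∃ λ c′ → Family 1 c′ F
family-from-1 ℕ.zero  f = _ , f
family-from-1 (suc N) f = family-from-1 N (skip f)

interval : ℕ → ℕ → List ℕ
interval p ℕ.zero  = []
interval p (suc d) = p ∷ interval (suc p) d

∈-interval : ∀ d {j} → p ℕ.≤ j → j ℕ.< d ℕ.+ p → j ∈ interval p d
∈-interval ℕ.zero p≤j j<p = ⊥-elim (ℕ.<⇒≱ j<p p≤j)
∈-interval {p} (suc d) {j} p≤j j< with p ℕ.≟ j
... | yes refl = here refl
... | no p≢j   = there (∈-interval d (ℕ.≤∧≢⇒< p≤j p≢j) (subst (j ℕ.<_) (sym (ℕ.+-suc d p)) j<))

interval-∷ : ∀ d → Family (suc d ℕ.+ p) c F → Family p (suc d ℕ.+ c) (interval p (suc d) ∷ F)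
interval-∷ ℕ.zero f = start f
interval-∷ {p} {c} {F} (suc d) f =
  grow (interval-∷ d (subst (λ q → Family q c F) (cong suc (sym (ℕ.+-suc d p))) f))

-- Cutting a family down to a bounded range

Agree : ℕ → List ℕ → List ℕ → Set
Agree q E E′ = ∀ j → j ℕ.< q → does (j ∈? E) ≡ does (j ∈? E′)

-- Each surviving set keeps its first element `e`. Hence the minimum of the family is untouched
-- while the number of sets can only drop, which is why admissibility is inherited.
data Trimmed (q : ℕ) : List (List ℕ) → List (List ℕ) → Set where
  drop : AllAbove q F → Trimmed q F []
  keep : ∀ {e} → Agree q (e ∷ E) (e ∷ E′) → Trimmed q F F′ →
         Trimmed q ((e ∷ E) ∷ F) ((e ∷ E′) ∷ F′)

above⇒agree : ∀ E → All (q ℕ.≤_) E → Agree q E []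
above⇒agree E q≤ j j<q =
  dec-false (j ∈? E) λ j∈E → ℕ.<⇒≱ j<q (All.lookup q≤ j∈E)

agree-∷ : ∀ e E E′ → Agree q E E′ → Agree q (e ∷ E) (e ∷ E′)
agree-∷ e E E′ a j j<q = cong (does (j ℕ.≟ e) ∨_) (a j j<q)

trim : ∀ {d} c → p ℕ.+ c ≡ q → Family p d F → ∃ λ F′ → Family p c F′ × Trimmed q F F′
trim {p} ℕ.zero eq f = [] , empty ,
  drop (subst (λ q → AllAbove q _) (trans (sym (ℕ.+-identityʳ p)) eq) (family-above f))
trim (suc c) eq empty = [] , no-blocks _ _ , drop []
trim {p} (suc c) eq (skip f) with trim c (trans (sym (ℕ.+-suc p c)) eq) f
... | F′ , f′ , t = F′ , skip f′ , t
trim {p} (suc c) eq (start f) with trim c (trans (sym (ℕ.+-suc p c)) eq) f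
... | F′ , f′ , t = _ , start f′ , keep (λ _ _ → refl) t
trim {p} (suc c) eq (grow f) with trim c (trans (sym (ℕ.+-suc p c)) eq) f
-- Here the cut falls right after `p`: the rest of the first set lies beyond `q`, so the trimmed set
-- is the singleton of `p` and `grow` becomes `start`.
... | _ , f′ , drop {F = E ∷ _} (E≥ ∷ F≥) = _ , start f′ , keep (agree-∷ p E [] (above⇒agree E E≥)) (drop F≥)
... | _ , f′ , keep {E = E} {E′} {e = e} a t = _ , grow f′ , keep (agree-∷ p (e ∷ E) (e ∷ E′) a) t

Trimmed-length : Trimmed q F F′ → length F′ ℕ.≤ length F
Trimmed-length (drop _)   = ℕ.z≤n
Trimmed-length (keep _ t) = ℕ.s≤s (Trimmed-length t)

admissible-≤ : ∀ e E F → T (admissible ((e ∷ E) ∷ F)) → suc (length F) ℕ.≤ e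
admissible-≤ e E F = ℕ.≤ᵇ⇒≤ (suc (length F)) e

≤-admissible : ∀ e E F → suc (length F) ℕ.≤ e → T (admissible ((e ∷ E) ∷ F))
≤-admissible e E F = ℕ.≤⇒≤ᵇ

Trimmed-admissible : Trimmed q F F′ → T (admissible F) → T (admissible F′)
Trimmed-admissible (drop _) _ = _
Trimmed-admissible (keep {E} {E′} {F} {F′} {e} _ t) adm =
  ≤-admissible e E′ F′ (ℕ.≤-trans (ℕ.s≤s (Trimmed-length t)) (admissible-≤ e E F adm))

-- Tsirelson norms

0≤½ : 0ℚ ≤ ½
0≤½ = nonNegative⁻¹ ½

½*-mono : ∀ {a b} → a ≤ b → ½ * a ≤ ½ * b
½*-mono = *-monoˡ-≤-nonNeg ½

blockSum : ℕ → C00 → List (List ℕ) → ℚ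
blockSum m x F = foldr (λ E r → tsNorm m (restrict E x) + r) 0ℚ F

module _ {A : Set} (f : A → ℚ) where

  ≤-foldr-⊔ : ∀ {a as} → a ∈ as → f a ≤ foldr _⊔_ 0ℚ (map f as)
  ≤-foldr-⊔ (here refl) = p≤p⊔q _ _
  ≤-foldr-⊔ {as = b ∷ as} (there a∈) = ≤-trans (≤-foldr-⊔ a∈) (p≤q⊔p (f b) _)

  foldr-⊔-≤ : ∀ {r as} → 0ℚ ≤ r → (∀ {a} → a ∈ as → f a ≤ r) → foldr _⊔_ 0ℚ (map f as) ≤ r
  foldr-⊔-≤ {as = []}     0≤r f≤r = 0≤r
  foldr-⊔-≤ {as = a ∷ as} 0≤r f≤r = ⊔-lub (f≤r (here refl)) (foldr-⊔-≤ 0≤r (f≤r ∘ there))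

  *-foldr-⊔ : ∀ {g : A → ℚ} r .{{_ : NonNegative r}} → (∀ a → g a ≡ r * f a) → ∀ as →
    foldr _⊔_ 0ℚ (map g as) ≡ r * foldr _⊔_ 0ℚ (map f as)
  *-foldr-⊔ r eq []       = sym (*-zeroʳ r)
  *-foldr-⊔ r eq (a ∷ as) = trans (cong₂ _⊔_ (eq a) (*-foldr-⊔ r eq as))
    (sym (*-distribˡ-⊔-nonNeg r (f a) _))

!≤supNorm : ∀ x j → ∣ x ! j ∣ ≤ supNorm x
!≤supNorm []      j        = ≤-refl
!≤supNorm (a ∷ x) ℕ.zero  = p≤p⊔q _ _
!≤supNorm (a ∷ x) (suc j) = ≤-trans (!≤supNorm x j) (p≤q⊔p ∣ a ∣ _)

supNorm≤ : ∀ x {r} → 0ℚ ≤ r → (∀ j → ∣ x ! j ∣ ≤ r) → supNorm x ≤ r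
supNorm≤ []      0≤r x≤r = 0≤r
supNorm≤ (a ∷ x) 0≤r x≤r = ⊔-lub (x≤r 0) (supNorm≤ x 0≤r (x≤r ∘ suc))

tsNorm-suc : ∀ m x → tsNorm m x ≤ tsNorm (suc m) x
tsNorm-suc m x = p≤p⊔q _ _

0≤tsNorm : ∀ m x → 0ℚ ≤ tsNorm m x
0≤tsNorm ℕ.zero  x = ≤-trans (0≤∣p∣ (x ! 0)) (!≤supNorm x 0)
0≤tsNorm (suc m) x = ≤-trans (0≤tsNorm m x) (tsNorm-suc m x)

-- The upper half of the universal property of the maximum; `½blockSum≤tsNorm` is the lower half.
-- Most estimates below use these two in place of the list of families.
tsNorm-suc-≤ : ∀ m x {r} → tsNorm m x ≤ r →
  (∀ {F} → Family 1 (length x) F → T (admissible F) → ½ * blockSum m x F ≤ r) →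
  tsNorm (suc m) x ≤ r
tsNorm-suc-≤ m x x≤r F≤r = ⊔-lub x≤r
  (foldr-⊔-≤ _ (≤-trans (0≤tsNorm m x) x≤r) λ F∈ →
    let F∈fam , adm = ∈-filter⁻ (T? ∘ admissible) {xs = families 1 (length x)} F∈
    in F≤r (∈-families⁻ 1 (length x) F∈fam) adm)

blockSum-mono : ∀ m x y F →
  (∀ {E} → E ∈ F → tsNorm m (restrict E x) ≤ tsNorm m (restrict E y)) →
  blockSum m x F ≤ blockSum m y F
blockSum-mono m x y []      le = ≤-refl
blockSum-mono m x y (E ∷ F) le =
  +-mono-≤ (le (here refl)) (blockSum-mono m x y F (le ∘ there))

Zero : C00 → Set
Zero x = ∀ j → x ! j ≡ 0ℚ

tsNorm-zero  : ∀ m x → Zero x → tsNorm m x ≤ 0ℚ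
blockSum-zero : ∀ m x F → Zero x → blockSum m x F ≤ 0ℚ

tsNorm-zero ℕ.zero  x x≡0 = supNorm≤ x ≤-refl λ j → ≤-reflexive (cong ∣_∣ (x≡0 j))
tsNorm-zero (suc m) x x≡0 = tsNorm-suc-≤ m x (tsNorm-zero m x x≡0)
  λ {F} _ _ → ½*-mono (blockSum-zero m x F x≡0)

blockSum-zero m x []      x≡0 = ≤-refl
blockSum-zero m x (E ∷ F) x≡0 =
  +-mono-≤ (tsNorm-zero m (restrict E x) λ j → restrict-!-0 E x (x≡0 j)) (blockSum-zero m x F x≡0)

-- Indices are 1-based, so every coordinate of `x` has index below `suc (length x)`. Dropped sets
-- restrict `x` to zero, and kept sets restrict it exactly as before.
blockSum-trimmed : ∀ m x → Trimmed (suc (length x)) F F′ → blockSum m x F ≤ blockSum m x F′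
blockSum-trimmed m x (drop [])        = ≤-refl
blockSum-trimmed m x (drop {F = E ∷ _} (E≥ ∷ F≥)) = +-mono-≤
  (tsNorm-zero m (restrict E x) λ j →
    trans (cong (_! j) (restrictFrom-cong 1 x (above⇒agree E E≥))) (restrictFrom-! 1 [] x j))
  (blockSum-trimmed m x (drop F≥))
blockSum-trimmed m x (keep a t) = +-mono-≤
  (≤-reflexive (cong (tsNorm m) (restrictFrom-cong 1 x a)))
  (blockSum-trimmed m x t)

-- The families in the definition of the norm are confined to {1, …, length x};
-- families reaching further obey the same bound.
½blockSum≤tsNorm : ∀ m x → Family 1 c F → T (admissible F) → ½ * blockSum m x F ≤ tsNorm (suc m) x
½blockSum≤tsNorm m x f adm with trim (length x) refl f
... | F′ , f′ , t = ≤-trans (½*-mono (blockSum-trimmed m x t)) (≤-trans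
  (≤-foldr-⊔ (λ F → ½ * blockSum m x F)
    (∈-filter⁺ (T? ∘ admissible) (∈-families⁺ f′) (Trimmed-admissible t adm)))
  (p≤q⊔p (tsNorm m x) _))

-- Monotonicity, triangle inequality and homogeneity of the norms

infix 4 _≼_
_≼_ : C00 → C00 → Set
x ≼ y = ∀ j → ∣ x ! j ∣ ≤ ∣ y ! j ∣

-- The hypothesis is local to `E` so that `x ⊕ s` can be compared with `s` on sets that avoid the
-- support of `x`.
restrict-≼ : ∀ x y E → (∀ {j} → suc j ∈ E → ∣ x ! j ∣ ≤ ∣ y ! j ∣) → restrict E x ≼ restrict E y
restrict-≼ x y E x≼y j rewrite restrictFrom-! 1 E x j | restrictFrom-! 1 E y j
  with suc j ∈? E
... | yes j∈E = x≼y j∈E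
... | no _    = ≤-refl

0≼ : ∀ {a b} → a ≡ 0ℚ → ∣ a ∣ ≤ ∣ b ∣
0≼ {b = b} a≡0 = ≤-trans (≤-reflexive (cong ∣_∣ a≡0)) (0≤∣p∣ b)

-- A family for `x` is tested on `y`, by induction on `m`. The list `x` may be longer than `y`, so
-- the family may overrun `y`, which `½blockSum≤tsNorm` tolerates.
tsNorm-mono : ∀ m {x y} → x ≼ y → tsNorm m x ≤ tsNorm m y
tsNorm-mono ℕ.zero  {x} {y} x≼y = supNorm≤ x (0≤tsNorm 0 y) λ j → ≤-trans (x≼y j) (!≤supNorm y j)
tsNorm-mono (suc m) {x} {y} x≼y = tsNorm-suc-≤ m x
  (≤-trans (tsNorm-mono m x≼y) (tsNorm-suc m y))
  λ {F} f adm → ≤-trans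
    (½*-mono (blockSum-mono m x y F λ {E} _ → tsNorm-mono m (restrict-≼ x y E λ {j} _ → x≼y j)))
    (½blockSum≤tsNorm m y f adm)

tsNorm-restrict : ∀ m E x → tsNorm m (restrict E x) ≤ tsNorm m x
tsNorm-restrict m E x = tsNorm-mono m restrict≼
  where
  restrict≼ : restrict E x ≼ x
  restrict≼ j rewrite restrictFrom-! 1 E x j with does (suc j ∈? E)
  ... | true  = ≤-refl
  ... | false = 0≤∣p∣ (x ! j)

+-interchange : ∀ a b c d → (a + b) + (c + d) ≡ (a + c) + (b + d)
+-interchange = solve 4 (λ a b c d → (a :+ b) :+ (c :+ d) := (a :+ c) :+ (b :+ d)) refl
  where open ℚ-Solver

-- Restriction is additive, and a family admissible for the sum is admissible for each summand,
-- since admissibility does not depend on the vector.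
tsNorm-⊕  : ∀ m x y → tsNorm m (x ⊕ y) ≤ tsNorm m x + tsNorm m y
blockSum-⊕ : ∀ m x y F → blockSum m (x ⊕ y) F ≤ blockSum m x F + blockSum m y F

tsNorm-⊕ ℕ.zero  x y = supNorm≤ (x ⊕ y) (+-mono-≤ (0≤tsNorm 0 x) (0≤tsNorm 0 y)) λ j →
  ≤-trans (≤-reflexive (cong ∣_∣ (⊕-! x y j)))
  (≤-trans (∣p+q∣≤∣p∣+∣q∣ (x ! j) (y ! j)) (+-mono-≤ (!≤supNorm x j) (!≤supNorm y j)))
tsNorm-⊕ (suc m) x y = tsNorm-suc-≤ m (x ⊕ y)
  (≤-trans (tsNorm-⊕ m x y) (+-mono-≤ (tsNorm-suc m x) (tsNorm-suc m y)))
  λ {F} f adm → ≤-trans (½*-mono (blockSum-⊕ m x y F)) (≤-trans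
    (≤-reflexive (*-distribˡ-+ ½ (blockSum m x F) (blockSum m y F)))
    (+-mono-≤ (½blockSum≤tsNorm m x f adm) (½blockSum≤tsNorm m y f adm)))

blockSum-⊕ m x y []      = ≤-refl
blockSum-⊕ m x y (E ∷ F) rewrite restrictFrom-⊕ 1 E x y = ≤-trans
  (+-mono-≤ (tsNorm-⊕ m (restrict E x) (restrict E y)) (blockSum-⊕ m x y F))
  (≤-reflexive (+-interchange (tsNorm m (restrict E x)) (tsNorm m (restrict E y)) _ _))

module _ (r : ℚ) .{{r≥0 : NonNegative r}} where

  supNorm-scale : ∀ x → supNorm (scale r x) ≡ r * supNorm x
  supNorm-scale []      = sym (*-zeroʳ r)
  supNorm-scale (a ∷ x) = trans
    (cong₂ _⊔_ (trans (∣p*q∣≡∣p∣*∣q∣ r a) (cong (_* ∣ a ∣) (0≤p⇒∣p∣≡p (nonNegative⁻¹ r))))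
               (supNorm-scale x))
    (sym (*-distribˡ-⊔-nonNeg r ∣ a ∣ (supNorm x)))

  tsNorm-scale   : ∀ m x → tsNorm m (scale r x) ≡ r * tsNorm m x
  blockSum-scale : ∀ m x F → blockSum m (scale r x) F ≡ r * blockSum m x F

  tsNorm-scale ℕ.zero  x = supNorm-scale x
  -- Scaling preserves the length, so both maxima run over the same list of families.
  tsNorm-scale (suc m) x rewrite length-map (r *_) x = trans
    (cong₂ _⊔_ (tsNorm-scale m x)
      (*-foldr-⊔ (λ F → ½ * blockSum m x F) r ½scale (admissibleFamilies x)))
    (sym (*-distribˡ-⊔-nonNeg r (tsNorm m x) _))
    where
    open ℚ-Solver
    ½scale : ∀ F → ½ * blockSum m (scale r x) F ≡ r * (½ * blockSum m x F)
    ½scale F = trans (cong (½ *_) (blockSum-scale m x F))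
      (solve 3 (λ h r b → h :* (r :* b) := r :* (h :* b)) refl ½ r (blockSum m x F))

  blockSum-scale m x []      = sym (*-zeroʳ r)
  blockSum-scale m x (E ∷ F) rewrite restrictFrom-scale r 1 E x = trans
    (cong₂ _+_ (tsNorm-scale m (restrict E x)) (blockSum-scale m x F))
    (sym (*-distribˡ-+ r (tsNorm m (restrict E x)) (blockSum m x F)))

-- Natural numbers as rational constants

ι : ℕ → ℚ
ι ℕ.zero  = 0ℚ
ι (suc n) = 1ℚ + ι n

0≤ι : ∀ n → 0ℚ ≤ ι n
0≤ι ℕ.zero  = ≤-refl
0≤ι (suc n) = +-mono-≤ (nonNegative⁻¹ 1ℚ) (0≤ι n)

ι-mono : ∀ {m n} → m ℕ.≤ n → ι m ≤ ι n
ι-mono {n = n} ℕ.z≤n = 0≤ι n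
ι-mono (ℕ.s≤s m≤n)   = +-monoʳ-≤ 1ℚ (ι-mono m≤n)

ι-+ : ∀ m n → ι (m ℕ.+ n) ≡ ι m + ι n
ι-+ ℕ.zero  n = sym (+-identityˡ (ι n))
ι-+ (suc m) n = trans (cong (λ a → 1ℚ + a) (ι-+ m n)) (sym (+-assoc 1ℚ (ι m) (ι n)))

ι-*-mono : ∀ {m n a} → 0ℚ ≤ a → m ℕ.≤ n → ι m * a ≤ ι n * a
ι-*-mono {a = a} 0≤a m≤n = *-monoʳ-≤-nonNeg a {{nonNegative 0≤a}} (ι-mono m≤n)

-- `_/_` reduces to lowest terms and is stuck on a variable `n`. Over unnormalised rationals the
-- identity is a cross-multiplication for the ring solver.
/4-suc : ∀ n → (+ suc n) / 4 ≡ (+ 1) / 4 + (+ n) / 4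
/4-suc n = toℚᵘ-injective (begin
  toℚᵘ ((+ suc n) / 4)                  ≈⟨ toℚᵘ-fromℚᵘ (mkℚᵘ (+ suc n) 3) ⟩
  mkℚᵘ (+ suc n) 3                      ≈⟨ *≡* (solve 1 (λ n →
    (con (+ 1) :+ n) :* con (+ 16) := (con (+ 1) :* con (+ 4) :+ n :* con (+ 4)) :* con (+ 4)) refl (+ n)) ⟩
  mkℚᵘ (+ 1) 3 ℚᵘ.+ mkℚᵘ (+ n) 3        ≈⟨ ℚᵘ.+-congʳ (mkℚᵘ (+ 1) 3) (toℚᵘ-fromℚᵘ (mkℚᵘ (+ n) 3)) ⟨
  toℚᵘ ((+ 1) / 4) ℚᵘ.+ toℚᵘ ((+ n) / 4) ≈⟨ toℚᵘ-homo-+ ((+ 1) / 4) ((+ n) / 4) ⟨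
  toℚᵘ ((+ 1) / 4 + (+ n) / 4)          ∎)
  where
  open ℚᵘ.≃-Reasoning
  open +-*-Solver

ι/4 : ∀ n → (+ n) / 4 ≡ ½ * (ι n * ½)
ι/4 ℕ.zero  = refl
ι/4 (suc n) = trans (/4-suc n) (trans (cong (λ a → (+ 1) / 4 + a) (ι/4 n))
  (solve 1 (λ a → con ((+ 1) / 4) :+ con ½ :* (a :* con ½) := con ½ :* ((con 1ℚ :+ a) :* con ½)) refl (ι n)))
  where open ℚ-Solver

-- A crude count, each set contributing at most the whole norm. It is effective for the tail of a
-- sequence, whose norm is tiny compared with the number of sets.
blockSum≤ : ∀ m x F → blockSum m x F ≤ ι (length F) * tsNorm m x
blockSum≤ m x []      = ≤-reflexive (sym (*-zeroˡ (tsNorm m x)))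
blockSum≤ m x (E ∷ F) = ≤-trans (+-mono-≤ (tsNorm-restrict m E x) (blockSum≤ m x F))
  (≤-reflexive (solve 2 (λ a i → a :+ i :* a := (con 1ℚ :+ i) :* a) refl (tsNorm m x) (ι (length F))))
  where open ℚ-Solver

-- Sequences of successive normalised vectors

-- `n` successive sets beyond `N`, together worth at least `n` halves on `s`. Asking this of every
-- `y` that agrees with `s` from position `N` on lets the cover survive when further vectors are put
-- in front. Position `N` carries index `suc N`, where the family starts.
Cover : ℕ → ℕ → ℕ → C00 → Set
Cover k n N s = ∃ λ c → ∃ λ F → Family (suc N) c F × length F ≡ n ×
  (∀ y → (∀ {j} → N ℕ.≤ j → y ! j ≡ s ! j) → ι n * ½ ≤ blockSum k y F)

record Spread (k n N : ℕ) : Set where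
  field
    vectors    : Fin n → C00
  total : C00
  total = sumC00 vectors
  field
    normalised : ∀ i → tsNorm k (vectors i) ≡ ½
    supported  : ∀ {j} → j ℕ.< N → total ! j ≡ 0ℚ
    bounded    : tsNorm k total ≤ 1ℚ
    cover      : Cover k n N total
open Spread

-- The new set is the interval of indices from `N + 1` to `N + d + 1`, which contains the support of
-- `x`. There `y` agrees with `x`; beyond it `x` vanishes, so `y` agrees with `s` and the old cover
-- applies.
cover-∷ : ∀ k d x s → ½ ≤ tsNorm k x →
  (∀ {j} → j ℕ.< N → x ! j ≡ 0ℚ) → (∀ {j} → suc d ℕ.+ N ℕ.≤ j → x ! j ≡ 0ℚ) →
  (∀ {j} → j ℕ.< suc d ℕ.+ N → s ! j ≡ 0ℚ) →
  Cover k n (suc d ℕ.+ N) s → Cover k (suc n) N (x ⊕ s)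
cover-∷ {N} {n} k d x s ½≤x x<N x≥N′ s<N′ (c , F , f , len , F≥) =
  _ , interval (suc N) (suc d) ∷ F ,
  interval-∷ d (subst (λ q → Family q c F) (cong suc (sym (ℕ.+-suc d N))) f) ,
  cong suc len , λ y y≡ → ≤-trans
    (≤-reflexive (solve 1 (λ i → (con 1ℚ :+ i) :* con ½ := con ½ :+ i :* con ½) refl (ι n)))
    (+-mono-≤
      (≤-trans ½≤x (tsNorm-mono k (x≼ y y≡)))
      (F≥ y λ {j} N′≤j → trans (y≡ (ℕ.≤-trans (ℕ.m≤n+m N (suc d)) N′≤j)) (⊕-!ʳ x s (x≥N′ N′≤j))))
  where
  open ℚ-Solver
  x≼ : ∀ y → (∀ {j} → N ℕ.≤ j → y ! j ≡ (x ⊕ s) ! j) → x ≼ restrict (interval (suc N) (suc d)) y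
  x≼ y y≡ j with j ℕ.<? N | j ℕ.<? suc d ℕ.+ N
  ... | yes j<N | _        = 0≼ (x<N j<N)
  ... | no _    | no j≮N′  = 0≼ (x≥N′ (ℕ.≮⇒≥ j≮N′))
  ... | no j≮N  | yes j<N′ = ≤-reflexive (cong ∣_∣ (sym (trans
    (restrict-!-∈ _ y (∈-interval (suc d) (ℕ.s≤s (ℕ.≮⇒≥ j≮N))
      (subst (suc j ℕ.<_) (cong suc (sym (ℕ.+-suc d N))) (ℕ.s≤s j<N′))))
    (trans (y≡ (ℕ.≮⇒≥ j≮N)) (⊕-!ˡ x s (s<N′ j<N′))))))

spread-[] : ∀ k N → Spread k 0 N
spread-[] k N = record
  { vectors    = λ ()
  ; normalised = λ ()
  ; supported  = λ _ → refl
  ; bounded    = ≤-trans (tsNorm-zero k [] λ _ → refl) (nonNegative⁻¹ 1ℚ)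
  ; cover      = 0 , [] , empty , refl , λ _ _ → ≤-refl
  }

spread-∷ : ∀ d x → tsNorm k x ≡ ½ →
  (∀ {j} → j ℕ.< N → x ! j ≡ 0ℚ) → (∀ {j} → suc d ℕ.+ N ℕ.≤ j → x ! j ≡ 0ℚ) →
  (S : Spread k n (suc d ℕ.+ N)) → tsNorm k (x ⊕ total S) ≤ 1ℚ → Spread k (suc n) N
spread-∷ {k} {N} d x x≡½ x<N x≥N′ S ≤1 = record
  { vectors    = x Vector.∷ vectors S
  ; normalised = λ { Fin.zero → x≡½ ; (Fin.suc i) → normalised S i }
  ; supported  = λ j<N → trans (⊕-!ˡ x (total S) (supported S (ℕ.<-≤-trans j<N (ℕ.m≤n+m N (suc d))))) (x<N j<N)
  ; bounded    = ≤1
  ; cover      = cover-∷ k d x (total S) (≤-reflexive (sym x≡½)) x<N x≥N′ (supported S) (cover S)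
  }

-- The cover has `n` sets and starts after `N`, so `n ≤ N` makes it admissible.
cover-tsNorm : ∀ k s → Cover k n N s → n ℕ.≤ N → ½ * (ι n * ½) ≤ tsNorm (suc k) s
cover-tsNorm {n} {N} k s (c , F , f , len , F≥) n≤N = ≤-trans
  (½*-mono (F≥ s λ _ → refl))
  (½blockSum≤tsNorm k s (proj₂ (family-from-1 N f)) (adm F f len))
  where
  adm : ∀ F → Family (suc N) c F → length F ≡ n → T (admissible F)
  adm []            f _   = _
  adm ([] ∷ F)      f _   = family-nonempty f
  adm ((e ∷ E) ∷ F) f len with family-above f
  ... | (N<e ∷ _) ∷ _ =
    ≤-admissible e E F (ℕ.≤-trans (ℕ.≤-reflexive len) (ℕ.≤-trans n≤N (ℕ.<⇒≤ N<e)))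

-- Base of the induction: the sup norm

unit : ℕ → C00
unit ℕ.zero  = ½ ∷ []
unit (suc N) = 0ℚ ∷ unit N

unit-< : ∀ N {j} → j ℕ.< N → unit N ! j ≡ 0ℚ
unit-< (suc N) {ℕ.zero} _           = refl
unit-< (suc N) {suc j}  (ℕ.s≤s j<N) = unit-< N j<N

unit-> : ∀ N {j} → N ℕ.< j → unit N ! j ≡ 0ℚ
unit-> ℕ.zero  {suc j} _           = refl
unit-> (suc N) {suc j} (ℕ.s≤s N<j) = unit-> N N<j

supNorm-unit : ∀ N → supNorm (unit N) ≡ ½
supNorm-unit ℕ.zero  = refl
supNorm-unit (suc N) = trans (p≤q⇒p⊔q≡q (0≤tsNorm 0 (unit N))) (supNorm-unit N)

½≤1 : ½ ≤ 1ℚ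
½≤1 = +-monoʳ-≤ ½ 0≤½

spread₀ : ∀ n N → Spread 0 n N
spread₀ ℕ.zero  N = spread-[] 0 N
spread₀ (suc n) N = spread-∷ 0 (unit N) (supNorm-unit N) (unit-< N) (unit-> N) S
  (supNorm≤ (unit N ⊕ total S) (nonNegative⁻¹ 1ℚ) coordinate)
  where
  S = spread₀ n (suc N)
  coordinate : ∀ j → ∣ (unit N ⊕ total S) ! j ∣ ≤ 1ℚ
  -- The supports are disjoint: up to `N` only the unit vector counts, afterwards only the tail.
  coordinate j with j ℕ.<? suc N
  ... | yes j≤N = ≤-trans (≤-reflexive (cong ∣_∣ (⊕-!ˡ (unit N) (total S) (supported S j≤N))))
    (≤-trans (!≤supNorm (unit N) j) (≤-trans (≤-reflexive (supNorm-unit N)) ½≤1))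
  ... | no j≰N = ≤-trans (≤-reflexive (cong ∣_∣ (⊕-!ʳ (unit N) (total S) (unit-> N (ℕ.≮⇒≥ j≰N)))))
    (≤-trans (!≤supNorm (total S) j) (bounded S))

-- Inductive step from `k` to `suc k`

-- Supplies the blocks of the next level. The last condition is the bound 1/(D+1) on the `k`-norm,
-- written without division.
Small : ℕ → Set
Small k = ∀ N D → ∃ λ x → (∀ {j} → j ℕ.< N → x ! j ≡ 0ℚ) ×
  tsNorm (suc k) x ≡ ½ × ι (suc D) * tsNorm k x ≤ 1ℚ

spread⇒small : ∀ k → (∀ n N → Spread k n N) → Small k
spread⇒small k spread N D = scale r z , z<N , z≡½ , z≤
  where
  open ℚ-Solver
  -- With 2(D+1) vectors the lower bound on `t` is (D+1)/2, so rescaling by 1/(2t) leaves a `k`-norm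
  -- of at most 1/(D+1). The start `B + N` lies beyond `N` and also makes the `B` sets admissible.
  B = suc D ℕ.+ suc D
  S = spread B (B ℕ.+ N)
  z = total S
  t = tsNorm (suc k) z

  ½ι≤t : ½ * ι (suc D) ≤ t
  ½ι≤t = ≤-trans
    (≤-reflexive (trans
      (solve 1 (λ i → con ½ :* i := con ½ :* ((i :+ i) :* con ½)) refl (ι (suc D)))
      (cong (λ i → ½ * (i * ½)) (sym (ι-+ (suc D) (suc D))))))
    (cover-tsNorm k z (cover S) (ℕ.m≤m+n B N))

  instance
    t>0 : Positive t
    t>0 = positive (<-≤-trans (positive⁻¹ ½) (≤-trans (½*-mono (+-monoʳ-≤ 1ℚ (0≤ι D))) ½ι≤t))
    t≢0 : NonZero t
    t≢0 = pos⇒nonZero t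
    u≥0 : NonNegative (1/ t)
    u≥0 = pos⇒nonNeg (1/ t) {{1/pos⇒pos t}}

  r = ½ * 1/ t

  instance
    r≥0 : NonNegative r
    r≥0 = nonNeg*nonNeg⇒nonNeg ½ (1/ t)

  z<N : ∀ {j} → j ℕ.< N → scale r z ! j ≡ 0ℚ
  z<N {j} j<N = trans (scale-! r z j) (trans
    (cong (r *_) (supported S (ℕ.<-≤-trans j<N (ℕ.m≤n+m N B)))) (*-zeroʳ r))

  z≡½ : tsNorm (suc k) (scale r z) ≡ ½
  z≡½ = trans (tsNorm-scale r (suc k) z)
    (trans (*-assoc ½ (1/ t) t) (cong (½ *_) (*-inverseˡ t)))

  z≤ : ι (suc D) * tsNorm k (scale r z) ≤ 1ℚ
  z≤ = begin
    ι (suc D) * tsNorm k (scale r z)    ≡⟨ cong (ι (suc D) *_) (tsNorm-scale r k z) ⟩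
    ι (suc D) * (r * tsNorm k z)        ≤⟨ *-monoˡ-≤-nonNeg (ι (suc D)) {{nonNegative (0≤ι (suc D))}}
                                             (*-monoˡ-≤-nonNeg r (bounded S)) ⟩
    ι (suc D) * (r * 1ℚ)                ≡⟨ solve 3 (λ i h u → i :* (h :* u :* con 1ℚ) := u :* (h :* i)) refl
                                             (ι (suc D)) ½ (1/ t) ⟩
    1/ t * (½ * ι (suc D))              ≤⟨ *-monoˡ-≤-nonNeg (1/ t) ½ι≤t ⟩
    1/ t * t                            ≡⟨ *-inverseˡ t ⟩
    1ℚ                                  ∎
    where open ≤-Reasoning

-- A family beginning before N₁ has at most N₁ members, so its share of s is at
-- most ½ N₁ ‖s‖ₖ ≤ ½; a family beginning later does not meet x.
tsNorm-⊕-≤1 : ∀ k N₁ x s → (∀ {j} → N₁ ℕ.≤ j → x ! j ≡ 0ℚ) →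
  tsNorm k (x ⊕ s) ≤ 1ℚ → tsNorm (suc k) x ≤ ½ →
  tsNorm (suc k) s ≤ 1ℚ → ι (suc N₁) * tsNorm k s ≤ 1ℚ →
  tsNorm (suc k) (x ⊕ s) ≤ 1ℚ
tsNorm-⊕-≤1 k N₁ x s x≥N₁ ≤1 x≤½ s≤1 small = tsNorm-suc-≤ k (x ⊕ s) ≤1 λ {F} → blocks≤1 F
  where
  blocks≤1 : ∀ F → Family 1 c F → T (admissible F) → ½ * blockSum k (x ⊕ s) F ≤ 1ℚ
  blocks≤1 []      f adm = nonNegative⁻¹ 1ℚ
  blocks≤1 ([] ∷ F) f adm = family-nonempty f
  blocks≤1 F@((e ∷ E) ∷ F₀) f adm with e ℕ.≤? N₁
  ... | yes e≤N₁ = begin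
    ½ * blockSum k (x ⊕ s) F                  ≤⟨ ½*-mono (blockSum-⊕ k x s F) ⟩
    ½ * (blockSum k x F + blockSum k s F)     ≡⟨ *-distribˡ-+ ½ (blockSum k x F) (blockSum k s F) ⟩
    ½ * blockSum k x F + ½ * blockSum k s F   ≤⟨ +-mono-≤ (≤-trans (½blockSum≤tsNorm k x f adm) x≤½)
      (½*-mono (≤-trans (blockSum≤ k s F) (≤-trans
        (ι-*-mono (0≤tsNorm k s)
          (ℕ.m≤n⇒m≤1+n (ℕ.≤-trans (admissible-≤ e E F₀ adm) e≤N₁))) small))) ⟩
    ½ + ½ * 1ℚ                                ≡⟨⟩
    1ℚ                                        ∎
    where open ≤-Reasoning
  -- An index `suc j` above `N₁` means a position `j` that is at least `N₁`, where `x` vanishes.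
  ... | no e≰N₁ = ≤-trans
    (½*-mono (blockSum-mono k (x ⊕ s) s F λ {E} E∈F → tsNorm-mono k
      (restrict-≼ (x ⊕ s) s E λ {j} j∈E → ≤-reflexive (cong ∣_∣ (⊕-!ʳ x s (x≥N₁
        (ℕ.s≤s⁻¹ (ℕ.≤-trans (ℕ.≰⇒> e≰N₁) (All.lookup (All.lookup (family-above-min f) E∈F) j∈E)))))))))
    (≤-trans (½blockSum≤tsNorm k s f adm) s≤1)

-- The second component strengthens the induction on `n`: it is the smallness that `tsNorm-⊕-≤1`
-- demands of the tail when one more block is put in front.
small⇒spread : ∀ k → Small k → ∀ n N →
  Σ (Spread (suc k) n N) λ S → ι (suc N) * tsNorm k (total S) ≤ 1ℚ
small⇒spread k small ℕ.zero N = spread-[] (suc k) N , (begin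
  ι (suc N) * tsNorm k []  ≤⟨ *-monoˡ-≤-nonNeg (ι (suc N)) {{nonNegative (0≤ι (suc N))}} (tsNorm-zero k [] λ _ → refl) ⟩
  ι (suc N) * 0ℚ           ≡⟨ *-zeroʳ (ι (suc N)) ⟩
  0ℚ                       ≤⟨ nonNegative⁻¹ 1ℚ ⟩
  1ℚ                       ∎)
  where open ≤-Reasoning
-- This `D` makes `suc D` equal to `M + M`, so `x` takes only half of the smallness allowed to the
-- sum.
small⇒spread k small (suc n) N with small N (N ℕ.+ suc N)
-- The tail starts past the end of `x` and no earlier than 2N+1; the latter gives `2M≤`, hence the
-- other half of the allowance.
... | x , x<N , x≡½ , x≤ with small⇒spread k small n (suc (N ℕ.+ length x) ℕ.+ N)
... | S , s≤ = spread-∷ d x x≡½ x<N x≥N₁ S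
    (tsNorm-⊕-≤1 k N₁ x s x≥N₁ xs≤1 (≤-reflexive x≡½) (bounded S) s≤)
  , ιxs≤1
  where
  open ≤-Reasoning
  open ℚ-Solver
  d  = N ℕ.+ length x
  N₁ = suc d ℕ.+ N
  s  = total S
  M  = suc N
  a  = tsNorm k x
  b  = tsNorm k s

  x≥N₁ : ∀ {j} → N₁ ℕ.≤ j → x ! j ≡ 0ℚ
  x≥N₁ N₁≤j = !-beyond x (ℕ.≤-trans (ℕ.m≤n⇒m≤1+n (ℕ.≤-trans (ℕ.m≤n+m (length x) N) (ℕ.m≤m+n d N))) N₁≤j)

  2M≤ : M ℕ.+ M ℕ.≤ suc N₁
  2M≤ = ℕ.s≤s (ℕ.≤-trans (ℕ.≤-reflexive (ℕ.+-suc N N)) (ℕ.s≤s (ℕ.+-monoˡ-≤ N (ℕ.m≤m+n N (length x)))))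

  ιxs≤1 : ι M * tsNorm k (x ⊕ s) ≤ 1ℚ
  ιxs≤1 = begin
    ι M * tsNorm k (x ⊕ s)             ≤⟨ *-monoˡ-≤-nonNeg (ι M) {{nonNegative (0≤ι M)}} (tsNorm-⊕ k x s) ⟩
    ι M * (a + b)                      ≡⟨ solve 3 (λ i a b → i :* (a :+ b) :=
                                            con ½ :* ((i :+ i) :* a :+ (i :+ i) :* b)) refl (ι M) a b ⟩
    ½ * ((ι M + ι M) * a + (ι M + ι M) * b) ≡⟨ cong (λ i → ½ * (i * a + i * b)) (ι-+ M M) ⟨
    ½ * (ι (M ℕ.+ M) * a + ι (M ℕ.+ M) * b) ≤⟨ ½*-mono (+-mono-≤ x≤
                                            (≤-trans (ι-*-mono (0≤tsNorm k s) 2M≤) s≤)) ⟩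
    ½ * (1ℚ + 1ℚ)                      ≡⟨⟩
    1ℚ                                 ∎

  xs≤1 : tsNorm k (x ⊕ s) ≤ 1ℚ
  xs≤1 = begin
    tsNorm k (x ⊕ s)        ≡⟨ *-identityˡ (tsNorm k (x ⊕ s)) ⟨
    1ℚ * tsNorm k (x ⊕ s)   ≤⟨ ι-*-mono {1} {M} (0≤tsNorm k (x ⊕ s)) (ℕ.s≤s ℕ.z≤n) ⟩
    ι M * tsNorm k (x ⊕ s)  ≤⟨ ιxs≤1 ⟩
    1ℚ                      ∎

spread : ∀ k n N → Spread k n N
spread ℕ.zero  n N = spread₀ n N
spread (suc k) n N = proj₁ (small⇒spread k (spread⇒small k (spread k)) n N)

theorem7p3 : (k n : ℕ) →
    Σ (Fin n → C00) (λ xs →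
    ((i : Fin n) → tsNorm k (xs i) ≡ ½)
    × (tsNorm k (sumC00 xs) ≤ 1ℚ)
    × ((+ n) / 4 ≤ tsNorm (suc k) (sumC00 xs)))
theorem7p3 k n = vectors S , normalised S , bounded S ,
  ≤-trans (≤-reflexive (ι/4 n)) (cover-tsNorm k (total S) (cover S) ℕ.≤-refl)
  where
  -- Starting beyond `n` makes the cover by `n` sets admissible.
  S = spread k n n
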